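{- Let $\pi,\sigma\in S_n$. Then $\sigma\sim\pi$ if and only if either $D(\sigma)\cong D(\pi)$ or $D(\sigma)\cong D(\pi^{ -1})$, where $\cong$ denotes isomorphism of digraphs.
   Context: Inversion set: $E(\pi)=\{(i,j):1\le i<j\le n,\ \pi^{ -1}(i)>\pi^{ -1}(j)\}$. For $\pi\in S_n$, $D(\pi)$ is the digraph with vertex set $\{1,\dots,n\}$ and arc set $E(\pi)$. Geometric graphs: a geometric graph is a simple graph together with a straight-line drawing in the plane with vertices in general position (no three vertices collinear, no three edges crossing at a single point). Two edges cross if they meet at a point interior to both. A geo-isomorphism $f:\overline{G}\to\overline{H}$ is a bijection $f:V(G)\to V(H)$ such that $uv\in E(G)\iff f(u)f(v)\in E(H)$, and $xy$ crosses $uv$ in $\overline G$ iff $f(x)f(y)$ crosses $f(u)f(v)$ in $\overline H$. The vertex set of $K_{2,n}$ is $\{a,b\}\cup\{1,\dots,n\}$, with $a$ and $b$ each adjacent to all of $1,\dots,n$. Realization $\overline{K}_{2,n}(\pi)$ for $\pi\in S_n$: from each of two points $a,b\in\mathbb{R}^2$ draw $n$ rays, all on the same side of the line $ab$, such that each ray from $a$ meets each ray from $b$ (and generic, so that general position holds). Label the rays from $b$ as $1,\dots,n$ in increasing order of the angle they make with the segment $ba$; label the rays from $a$ as $\pi(1),\dots,\pi(n)$ in increasing order of the angle they make with the segment $ab$. Place vertex $i$ at the intersection of the two rays labeled $i$, and draw the segments $ai$, $bi$ for all $i$. Geo-equivalence: $\sigma\sim\pi$ iff $\overline{K}_{2,n}(\sigma)$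 and $\overline{K}_{2,n}(\pi)$ are geo-isomorphic. -}

module Defs where

open import Algebra.Apartness.Bundles using (HeytingField)
open import Data.Fin.Base using (Fin; _<_)
open import Data.Fin.Permutation using (Permutation′; _⟨$⟩ʳ_; _⟨$⟩ˡ_)
open import Data.Nat.Base using (ℕ)
open import Data.Product.Base using (Σ-syntax; ∃-syntax; _×_; _,_)
open import Data.Sum.Base using (_⊎_)
open import Data.Unit.Base using (⊤; tt)
open import Data.Empty using (⊥)
open import Function.Bundles using (_⇔_; _↔_; Inverse)
open import Level using (Level; _⊔_; suc; 0ℓ)
open import Relation.Binary.Core using (Rel)
open import Relation.Binary.Definitions using (Symmetric; Irreflexive)
open import Relation.Binary.PropositionalEquality.Core using (_≡_; _≢_)
open import Relation.Binary.Structures using (IsStrictPartialOrder)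
open import Relation.Nullary.Negation using (¬_)

record Digraph : Set₁ where
  field
    Vertex : Set
    Arc    : Rel Vertex 0ℓ

infix 4 _≅_

_≅_ : Digraph → Digraph → Set
G ≅ H = Σ[ f ∈ (G.Vertex ↔ H.Vertex) ]
  (∀ u v → G.Arc u v ⇔ H.Arc (Inverse.to f u) (Inverse.to f v))
  where
  module G = Digraph G
  module H = Digraph H

-- The set {1,…,n} is represented by Fin n.

E : ∀ {n} → Permutation′ n → Rel (Fin n) 0ℓ
E π i j = i < j × (π ⟨$⟩ˡ j) < (π ⟨$⟩ˡ i)

D : ∀ {n} → Permutation′ n → Digraph
D {n} π = record { Vertex = Fin n ; Arc = E π }

record SimpleGraph : Set₁ where
  field
    Vertex : Set
    Adj    : Rel Vertex 0ℓ
    sym    : Symmetric Adj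
    irrefl : Irreflexive _≡_ Adj

data K₂Vertex (n : ℕ) : Set where
  a b : K₂Vertex n
  mid : Fin n → K₂Vertex n

K₂Adj : ∀ {n} → Rel (K₂Vertex n) 0ℓ
K₂Adj a       (mid _) = ⊤
K₂Adj b       (mid _) = ⊤
K₂Adj (mid _) a       = ⊤
K₂Adj (mid _) b       = ⊤
K₂Adj _       _       = ⊥

K₂,_ : ℕ → SimpleGraph
K₂, n = record
  { Vertex = K₂Vertex n
  ; Adj    = K₂Adj
  ; sym    = λ {x} {y} → K₂-sym x y
  ; irrefl = λ { {x} _≡_.refl → K₂-irrefl x }
  }
  where
  K₂-sym : ∀ (x y : K₂Vertex n) → K₂Adj x y → K₂Adj y x
  K₂-sym a       (mid _) _ = tt
  K₂-sym b       (mid _) _ = tt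
  K₂-sym (mid _) a       _ = tt
  K₂-sym (mid _) b       _ = tt

  K₂-irrefl : ∀ (x : K₂Vertex n) → ¬ K₂Adj x x
  K₂-irrefl a       ()
  K₂-irrefl b       ()
  K₂-irrefl (mid _) ()

-- The library has no real numbers, so the plane is taken over an arbitrary
-- ordered field.  Trichotomy of _<_ is not assumed, only what is constructively
-- valid for the real line; with excluded middle these are exactly the ordered
-- fields in the usual sense, ℝ among them.

record OrderedField c ℓ₁ ℓ₂ ℓ₃ : Set (suc (c ⊔ ℓ₁ ⊔ ℓ₂ ⊔ ℓ₃)) where
  field
    heytingField : HeytingField c ℓ₁ ℓ₂

  open HeytingField heytingField public

  infix 4 _<ᶠ_

  field
    _<ᶠ_                 : Rel Carrier ℓ₃
    isStrictPartialOrder : IsStrictPartialOrder _≈_ _<ᶠ_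
    #⇔<⊎>                : ∀ x y → x # y ⇔ (x <ᶠ y ⊎ y <ᶠ x)
    +-monoʳ-<            : ∀ x {y z} → y <ᶠ z → x + y <ᶠ x + z
    *-pos                : ∀ {x y} → 0# <ᶠ x → 0# <ᶠ y → 0# <ᶠ x * y

module Plane {c ℓ₁ ℓ₂ ℓ₃} (F : OrderedField c ℓ₁ ℓ₂ ℓ₃) where

  open OrderedField F hiding (sym)

  infix  4 _≈ₚ_
  infixl 6 _+ₚ_ _-ₚ_
  infixl 7 _·_

  Point : Set c
  Point = Carrier × Carrier

  _≈ₚ_ : Rel Point ℓ₁
  (x , y) ≈ₚ (x′ , y′) = x ≈ x′ × y ≈ y′

  _+ₚ_ _-ₚ_ : Point → Point → Point
  (x , y) +ₚ (x′ , y′) = (x + x′ , y + y′)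
  (x , y) -ₚ (x′ , y′) = (x - x′ , y - y′)

  _·_ : Carrier → Point → Point
  t · (x , y) = (t * x , t * y)

  det : Point → Point → Carrier
  det (x , y) (x′ , y′) = x * y′ - y * x′

  Collinear : Point → Point → Point → Set ℓ₁
  Collinear p q r = det (q -ₚ p) (r -ₚ p) ≈ 0#

  InteriorTo : (p x y : Point) → Set (c ⊔ ℓ₁ ⊔ ℓ₃)
  InteriorTo p x y = ∃[ t ] 0# <ᶠ t × t <ᶠ 1# × p ≈ₚ x +ₚ t · (y -ₚ x)

  OnRay : (p origin direction : Point) → Set (c ⊔ ℓ₁ ⊔ ℓ₃)
  OnRay p o u = ∃[ t ] ¬ (t <ᶠ 0#) × p ≈ₚ o +ₚ t · u

  -- For u and v strictly on the same side of the line spanned by d: the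
  -- (unoriented, convex) angle between d and u is smaller than the one between
  -- d and v.  Call these angles α, β ∈ (0,π); then the product is a positive
  -- multiple of sin α · sin (β − α), whichever the side.
  SmallerAngle : (d u v : Point) → Set ℓ₃
  SmallerAngle d u v = 0# <ᶠ det d u * det u v

  SameEdge : {V : Set} (x y u v : V) → Set
  SameEdge x y u v = (x ≡ u × y ≡ v) ⊎ (x ≡ v × y ≡ u)

  record GeneralPosition (G : SimpleGraph)
                         (pos : SimpleGraph.Vertex G → Point)
                         : Set (c ⊔ ℓ₁ ⊔ ℓ₃) where
    open SimpleGraph G
    field
      distinct : ∀ {x y} → x ≢ y → ¬ (pos x ≈ₚ pos y)
      noThreeCollinear : ∀ {x y z} → x ≢ y → y ≢ z → x ≢ z →
        ¬ Collinear (pos x) (pos y) (pos z)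
      noThreeConcurrent : ∀ {x y u v w z} →
        Adj x y → Adj u v → Adj w z →
        ¬ SameEdge x y u v → ¬ SameEdge u v w z → ¬ SameEdge x y w z →
        ¬ (∃[ p ] InteriorTo p (pos x) (pos y)
                × InteriorTo p (pos u) (pos v)
                × InteriorTo p (pos w) (pos z))

  record GeometricGraph : Set (suc 0ℓ ⊔ c ⊔ ℓ₁ ⊔ ℓ₃) where
    field
      graph : SimpleGraph

    open SimpleGraph graph public

    field
      pos             : Vertex → Point
      generalPosition : GeneralPosition graph pos

    Crosses : (x y u v : Vertex) → Set (c ⊔ ℓ₁ ⊔ ℓ₃)
    Crosses x y u v =
      Adj x y × Adj u v × ¬ SameEdge x y u v ×
      (∃[ p ] InteriorTo p (pos x) (pos y) × InteriorTo p (pos u) (pos v))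

  GeoIsomorphic : GeometricGraph → GeometricGraph → Set (c ⊔ ℓ₁ ⊔ ℓ₃)
  GeoIsomorphic G H = Σ[ f ∈ (G.Vertex ↔ H.Vertex) ]
    let f′ = Inverse.to f in
    (∀ u v → G.Adj u v ⇔ H.Adj (f′ u) (f′ v)) ×
    (∀ x y u v → G.Crosses x y u v ⇔ H.Crosses (f′ x) (f′ y) (f′ u) (f′ v))
    where
    module G = GeometricGraph G
    module H = GeometricGraph H

  placement : ∀ {n} → Point → Point → (Fin n → Point) → K₂Vertex n → Point
  placement A B v a       = A
  placement A B v b       = B
  placement A B v (mid i) = v i

  -- Any drawing obtained by the ray construction for π.  The k-th ray from A
  -- (by angle) has direction rayA k and label π(k); the k-th ray from B has
  -- direction rayB k and label k.
  record Realization {n} (π : Permutation′ n) : Set (c ⊔ ℓ₁ ⊔ ℓ₃) where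
    field
      A B       : Point
      rayA rayB : Fin n → Point
      oneSide   :
        ((∀ k → 0# <ᶠ det (B -ₚ A) (rayA k)) × (∀ k → 0# <ᶠ det (B -ₚ A) (rayB k)))
        ⊎
        ((∀ k → det (B -ₚ A) (rayA k) <ᶠ 0#) × (∀ k → det (B -ₚ A) (rayB k) <ᶠ 0#))
      meet      : ∀ k l → ∃[ p ] OnRay p A (rayA k) × OnRay p B (rayB l)
      increasingA : ∀ {k l} → k < l → SmallerAngle (B -ₚ A) (rayA k) (rayA l)
      increasingB : ∀ {k l} → k < l → SmallerAngle (A -ₚ B) (rayB k) (rayB l)
      vertex    : Fin n → Point
      vertexOnA : ∀ k → OnRay (vertex (π ⟨$⟩ʳ k)) A (rayA k)
      vertexOnB : ∀ i → OnRay (vertex i) B (rayB i)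
      generic   : GeneralPosition (K₂, n) (placement A B vertex)

    position : K₂Vertex n → Point
    position = placement A B vertex

  K̄₂ : ∀ {n} {π : Permutation′ n} → Realization π → GeometricGraph
  K̄₂ {n} R = record
    { graph           = K₂, n
    ; pos             = Realization.position R
    ; generalPosition = Realization.generic R
    }

-- Seen from a, the segment ai stops before the ray bj or beyond it according to
-- the order of i and j at b, and symmetrically; so ai and bj cross exactly when
-- (j , i) is an inversion of π, while edges at a common hub never cross.  The
-- crossings therefore encode D(π).  For n ≥ 3 an automorphism of K₂,ₙ preserves
-- {a , b}: if it fixes a and b it is an isomorphism of the inversion digraphs; if
-- it exchanges them the arcs are reversed, and π maps D(π⁻¹) to the reverse of D(π).
module Submission where

open import Defs
open import Data.Fin.Permutation using (Permutation′; flip)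
open import Data.Nat.Base using (ℕ)
open import Data.Sum.Base using (_⊎_)
open import Function.Bundles using (_⇔_)

open import Algebra.Apartness.Bundles using (HeytingCommutativeRing)
import Algebra.Apartness.Properties.HeytingCommutativeRing as HeytingProperties
open import Algebra.Bundles using (CommutativeRing; RawRing)
import Algebra.Properties.Ring as RingProperties
import Algebra.Properties.Semiring.Mult.TCOptimised as Multiples
import Algebra.Solver.Ring as RingSolver
open import Algebra.Solver.Ring.AlmostCommutativeRing
  using (fromCommutativeRing; _-Raw-AlmostCommutative⟶_)
open import Data.Fin.Base using (Fin; zero; suc; _<_)
open import Data.Fin.Permutation using (_⟨$⟩ʳ_; _⟨$⟩ˡ_; inverseˡ; inverseʳ)
open import Data.Fin.Properties using (<-cmp)
open import Data.Maybe.Base using (map)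
import Data.Nat.Base as ℕ
import Data.Nat.Properties as ℕ
open import Data.Product.Base using (∃-syntax; _×_; _,_; proj₁; proj₂; swap)
open import Data.Product.Properties using (≡-dec)
open import Data.Sum.Base using (inj₁; inj₂; [_,_]′)
open import Function.Base using (_∘_; id)
open import Function.Bundles using (_↔_; Inverse; Equivalence; mk⇔; mk↔ₛ′)
open import Function.Construct.Composition using (_⇔-∘_; _↔-∘_)
open import Function.Construct.Identity using (⇔-id; ↔-id)
open import Function.Construct.Symmetry using (⇔-sym)
open import Relation.Binary.Definitions using (tri<; tri≈; tri>; WeaklyDecidable)
open import Relation.Binary.PropositionalEquality.Core as ≡ using (_≡_; _≢_)
import Relation.Binary.Reasoning.Setoid as ≈-Reasoning
open import Relation.Binary.Structures using (IsStrictPartialOrder)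
open import Relation.Nullary.Decidable using (dec⇒maybe)
open import Relation.Nullary.Negation using (¬_; contradiction)

-- Whether the segments `AP` and `BQ` cross is a question about two parameters in the unit interval.
-- By Cramer's rule the parameter `s` on `BQ` satisfies `s * m ≈ h` and `(1# - s) * m ≈ k`, where
-- `h` and `k` are the two determinants whose product defines `SmallerAngle` at `A`. So `0 < s < 1`
-- forces `h * k` to be positive, and a positive `h * k` yields such an `s`; the parameter on `AP`
-- is governed in the same way by the angles at `B`. The obstacle is that the order of the field has
-- no trichotomy: a sign may be split only for an element known to be apart from zero. Positive
-- products supply this apartness for their factors, and the angular comparison of two rays is
-- decided by the order on `Fin n`.

-- Ring identities with integer coefficients.

-- A pair (m , n) with m or n zero stands for the integer m − n.  Decidable integer coefficients
-- let the ring solver cancel terms, although equality in R is not decidable.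
module IntegerCoefficients {c ℓ} (R : CommutativeRing c ℓ) where

  open CommutativeRing R
  open RingProperties ring
  open Multiples semiring using (×-homo-+; ×1-homo-*) renaming (_×_ to infixl 8 _·_)
  open ≈-Reasoning setoid

  private
    Difference : Set
    Difference = ℕ × ℕ

    _⊝_ : ℕ → ℕ → Difference
    ℕ.suc m ⊝ ℕ.suc n = m ⊝ n
    m       ⊝ n       = m , n

    differences : RawRing _ _
    differences = record
      { Carrier = Difference
      ; _≈_ = _≡_
      ; _+_ = λ (m , n) (k , l) → (m ℕ.+ k) ⊝ (n ℕ.+ l)
      ; _*_ = λ (m , n) (k , l) → (m ℕ.* k ℕ.+ n ℕ.* l) ⊝ (m ℕ.* l ℕ.+ n ℕ.* k)
      ; -_ = swap
      ; 0# = 0 , 0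
      ; 1# = 1 , 0
      }

    open RawRing differences using () renaming (_+_ to _+ᵈ_; _*_ to _*ᵈ_; -_ to -ᵈ_)

    -- The first clause makes the literals 0# and 1# evaluate to themselves.
    ⟦_⟧ : Difference → Carrier
    ⟦ m , 0 ⟧ = m · 1#
    ⟦ m , n ⟧ = m · 1# - n · 1#

    +-minus-0 : ∀ x → x - 0# ≈ x
    +-minus-0 x = trans (+-congˡ -0#≈0#) (+-identityʳ x)

    value : ∀ m n → ⟦ m , n ⟧ ≈ m · 1# - n · 1#
    value m ℕ.zero = sym (+-minus-0 _)
    value m (ℕ.suc n) = refl

    interchange : ∀ w x y z → (w + x) + (y + z) ≈ (w + y) + (x + z)
    interchange w x y z = begin
      (w + x) + (y + z) ≈⟨ +-assoc w x _ ⟩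
      w + (x + (y + z)) ≈⟨ +-congˡ (+-assoc x y z) ⟨
      w + ((x + y) + z) ≈⟨ +-congˡ (+-congʳ (+-comm x y)) ⟩
      w + ((y + x) + z) ≈⟨ +-congˡ (+-assoc y x z) ⟩
      w + (y + (x + z)) ≈⟨ +-assoc w y _ ⟨
      (w + y) + (x + z) ∎

    minus-interchange : ∀ w x y z → (w + x) - (y + z) ≈ (w - y) + (x - z)
    minus-interchange w x y z =
      trans (+-congˡ (sym (-‿+-comm y z))) (interchange w x (- y) (- z))

    value-⊝ : ∀ m n → ⟦ m ⊝ n ⟧ ≈ m · 1# - n · 1#
    value-⊝ ℕ.zero    n         = value 0 n
    value-⊝ (ℕ.suc m) ℕ.zero    = value (ℕ.suc m) 0
    value-⊝ (ℕ.suc m) (ℕ.suc n) = begin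
      ⟦ m ⊝ n ⟧                              ≈⟨ value-⊝ m n ⟩
      m · 1# - n · 1#                        ≈⟨ +-identityˡ _ ⟨
      0# + (m · 1# - n · 1#)                 ≈⟨ +-congʳ (-‿inverseʳ 1#) ⟨
      (1# - 1#) + (m · 1# - n · 1#)          ≈⟨ minus-interchange _ _ _ _ ⟨
      (1# + m · 1#) - (1# + n · 1#)          ≈⟨ +-cong (×-homo-+ 1# 1 m) (-‿cong (×-homo-+ 1# 1 n)) ⟨
      ℕ.suc m · 1# - ℕ.suc n · 1#            ∎

    +-homo : ∀ x y → ⟦ x +ᵈ y ⟧ ≈ ⟦ x ⟧ + ⟦ y ⟧
    +-homo (m , n) (k , l) = begin
      ⟦ (m ℕ.+ k) ⊝ (n ℕ.+ l) ⟧               ≈⟨ value-⊝ (m ℕ.+ k) (n ℕ.+ l) ⟩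
      (m ℕ.+ k) · 1# - (n ℕ.+ l) · 1#         ≈⟨ +-cong (×-homo-+ 1# m k) (-‿cong (×-homo-+ 1# n l)) ⟩
      (m · 1# + k · 1#) - (n · 1# + l · 1#)   ≈⟨ minus-interchange _ _ _ _ ⟩
      (m · 1# - n · 1#) + (k · 1# - l · 1#)   ≈⟨ +-cong (value m n) (value k l) ⟨
      ⟦ m , n ⟧ + ⟦ k , l ⟧                   ∎

    minus-flip : ∀ y z → z - y ≈ - (y - z)
    minus-flip y z = begin
      z - y         ≈⟨ +-comm z (- y) ⟩
      - y + z       ≈⟨ +-congˡ (-‿involutive z) ⟨
      - y - - z     ≈⟨ -‿+-comm y (- z) ⟩
      - (y - z)     ∎

    *-minus : ∀ w x y z → (w * y + x * z) - (w * z + x * y) ≈ (w - x) * (y - z)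
    *-minus w x y z = begin
      (w * y + x * z) - (w * z + x * y)       ≈⟨ minus-interchange _ _ _ _ ⟩
      (w * y - w * z) + (x * z - x * y)       ≈⟨ +-cong (x[y-z]≈xy-xz w y z) (x[y-z]≈xy-xz x z y) ⟨
      w * (y - z) + x * (z - y)               ≈⟨ +-congˡ (*-congˡ (minus-flip y z)) ⟩
      w * (y - z) + x * - (y - z)             ≈⟨ +-congˡ (-‿distribʳ-* x _) ⟨
      w * (y - z) - x * (y - z)               ≈⟨ [y-z]x≈yx-zx (y - z) w x ⟨
      (w - x) * (y - z)                       ∎

    ×-homo-+* : ∀ m k n l → (m ℕ.* k ℕ.+ n ℕ.* l) · 1# ≈ (m · 1#) * (k · 1#) + (n · 1#) * (l · 1#)
    ×-homo-+* m k n l =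
      trans (×-homo-+ 1# (m ℕ.* k) (n ℕ.* l)) (+-cong (×1-homo-* m k) (×1-homo-* n l))

    *-homo : ∀ x y → ⟦ x *ᵈ y ⟧ ≈ ⟦ x ⟧ * ⟦ y ⟧
    *-homo (m , n) (k , l) = begin
      ⟦ (m , n) *ᵈ (k , l) ⟧                  ≈⟨ value-⊝ (m ℕ.* k ℕ.+ n ℕ.* l) (m ℕ.* l ℕ.+ n ℕ.* k) ⟩
      _                                       ≈⟨ +-cong (×-homo-+* m k n l) (-‿cong (×-homo-+* m l n k)) ⟩
      _                                       ≈⟨ *-minus (m · 1#) (n · 1#) (k · 1#) (l · 1#) ⟩
      (m · 1# - n · 1#) * (k · 1# - l · 1#)   ≈⟨ *-cong (value m n) (value k l) ⟨
      ⟦ m , n ⟧ * ⟦ k , l ⟧                   ∎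

    -‿homo : ∀ x → ⟦ -ᵈ x ⟧ ≈ - ⟦ x ⟧
    -‿homo (m , n) = begin
      ⟦ n , m ⟧                ≈⟨ value n m ⟩
      n · 1# - m · 1#          ≈⟨ +-comm _ _ ⟩
      - (m · 1#) + n · 1#      ≈⟨ +-congˡ (-‿involutive _) ⟨
      - (m · 1#) - - (n · 1#)  ≈⟨ -‿+-comm _ _ ⟩
      - (m · 1# - n · 1#)      ≈⟨ -‿cong (value m n) ⟨
      - ⟦ m , n ⟧              ∎

    morphism : differences -Raw-AlmostCommutative⟶ fromCommutativeRing R
    morphism = record
      { ⟦_⟧ = ⟦_⟧
      ; +-homo = +-homo
      ; *-homo = *-homo
      ; -‿homo = -‿homo
      ; 0-homo = refl
      ; 1-homo = refl
      }

    _≈?_ : WeaklyDecidable (λ x y → ⟦ x ⟧ ≈ ⟦ y ⟧)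
    x ≈? y = map (reflexive ∘ ≡.cong ⟦_⟧) (dec⇒maybe (≡-dec ℕ._≟_ ℕ._≟_ x y))

  open RingSolver differences (fromCommutativeRing R) morphism _≈?_ public
    using (solve; _:=_; _:+_; _:*_; _:-_; :-_; con)

-- Signs, apartness and ratios in an ordered field.

module OrderedFieldProperties {c ℓ₁ ℓ₂ ℓ₃} (F : OrderedField c ℓ₁ ℓ₂ ℓ₃) where

  open OrderedField F
  open HeytingCommutativeRing heytingCommutativeRing using (commutativeRing)
  open CommutativeRing commutativeRing using (ring)
  open RingProperties ring using (-0#≈0#)
  open HeytingProperties heytingCommutativeRing using (x-0≈x; #-congʳ; invertibleˡ⇒#)
  open IntegerCoefficients commutativeRing public
  open IsStrictPartialOrder isStrictPartialOrder
    using (<-respˡ-≈; <-respʳ-≈) renaming (trans to <-trans; irrefl to <ᶠ-irrefl)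
  open ≈-Reasoning setoid

  private
    variable
      x y z m h k : Carrier

  0<-resp : x ≈ y → 0# <ᶠ x → 0# <ᶠ y
  0<-resp = <-respʳ-≈

  0≮0 : x ≈ 0# → ¬ (0# <ᶠ x)
  0≮0 x≈0 0<x = <ᶠ-irrefl (sym x≈0) 0<x

  x<y⇒0<y-x : x <ᶠ y → 0# <ᶠ y - x
  x<y⇒0<y-x {x} {y} x<y =
    <-respˡ-≈ (-‿inverseˡ x) (<-respʳ-≈ (+-comm (- x) y) (+-monoʳ-< (- x) x<y))

  0<y-x⇒x<y : 0# <ᶠ y - x → x <ᶠ y
  0<y-x⇒x<y {y} {x} 0<y-x = <-respˡ-≈ (+-identityʳ x)
    (<-respʳ-≈ (solve 2 (λ x y → x :+ (y :- x) := y) refl x y) (+-monoʳ-< x 0<y-x))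

  x<0⇒0<-x : x <ᶠ 0# → 0# <ᶠ - x
  x<0⇒0<-x {x} x<0 = 0<-resp (+-identityˡ (- x)) (x<y⇒0<y-x x<0)

  0<x⇒x#0 : 0# <ᶠ x → x # 0#
  0<x⇒x#0 {x} 0<x = Equivalence.from (#⇔<⊎> x 0#) (inj₂ 0<x)

  x#0⇒sign : x # 0# → x <ᶠ 0# ⊎ 0# <ᶠ x
  x#0⇒sign {x} = Equivalence.to (#⇔<⊎> x 0#)

  x#0∧x≮0⇒0<x : x # 0# → ¬ (x <ᶠ 0#) → 0# <ᶠ x
  x#0∧x≮0⇒0<x x#0 x≮0 = [ (λ x<0 → contradiction x<0 x≮0) , id ]′ (x#0⇒sign x#0)

  #0-resp : x ≈ y → x # 0# → y # 0#
  #0-resp = #-congʳ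

  inverse : x # 0# → ∃[ y ] y * x ≈ 1#
  inverse {x} x#0 with #⇒invertible x#0
  ... | y , y[x-0]≈1 , _ = y , trans (*-congˡ (sym (x-0≈x x))) y[x-0]≈1

  -- If `z` inverts `x * y`, then `z * y` inverts `x`, and invertible elements are apart from zero.
  x*y#0⇒x#0 : x * y # 0# → x # 0#
  x*y#0⇒x#0 {x} {y} xy#0 with inverse xy#0
  ... | z , z[xy]≈1 = invertibleˡ⇒# (z * y , (begin
    z * y * (x - 0#)  ≈⟨ *-congˡ (x-0≈x x) ⟩
    z * y * x         ≈⟨ solve 3 (λ x y z → z :* y :* x := z :* (x :* y)) refl x y z ⟩
    z * (x * y)       ≈⟨ z[xy]≈1 ⟩
    1#                ∎))

  x*y#0⇒y#0 : x * y # 0# → y # 0#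
  x*y#0⇒y#0 {x} {y} = x*y#0⇒x#0 ∘ #0-resp (*-comm x y)

  *-cancelˡ-#0 : m # 0# → m * x ≈ m * y → x ≈ y
  *-cancelˡ-#0 {m} {x} {y} m#0 mx≈my with inverse m#0
  ... | n , nm≈1 = begin
    x            ≈⟨ *-identityˡ x ⟨
    1# * x       ≈⟨ *-congʳ nm≈1 ⟨
    n * m * x    ≈⟨ *-assoc n m x ⟩
    n * (m * x)  ≈⟨ *-congˡ mx≈my ⟩
    n * (m * y)  ≈⟨ *-assoc n m y ⟨
    n * m * y    ≈⟨ *-congʳ nm≈1 ⟩
    1# * y       ≈⟨ *-identityˡ y ⟩
    y            ∎

  0<x*y⇒x#0 : 0# <ᶠ x * y → x # 0#
  0<x*y⇒x#0 = x*y#0⇒x#0 ∘ 0<x⇒x#0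

  0<x*y⇒y#0 : 0# <ᶠ x * y → y # 0#
  0<x*y⇒y#0 = x*y#0⇒y#0 ∘ 0<x⇒x#0

  +-pos : 0# <ᶠ x → 0# <ᶠ y → 0# <ᶠ x + y
  +-pos {x} {y} 0<x 0<y = <-trans 0<x (<-respˡ-≈ (+-identityʳ x) (+-monoʳ-< x 0<y))

  *-neg : x <ᶠ 0# → y <ᶠ 0# → 0# <ᶠ x * y
  *-neg {x} {y} x<0 y<0 =
    0<-resp (solve 2 (λ x y → :- x :* :- y := x :* y) refl x y)
      (*-pos (x<0⇒0<-x x<0) (x<0⇒0<-x y<0))

  square-pos : x # 0# → 0# <ᶠ x * x
  square-pos x#0 = [ (λ x<0 → *-neg x<0 x<0) , (λ 0<x → *-pos 0<x 0<x) ]′ (x#0⇒sign x#0)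

  *-pos-cancelʳ : 0# <ᶠ y → 0# <ᶠ x * y → 0# <ᶠ x
  *-pos-cancelʳ {y} {x} 0<y 0<xy = x#0∧x≮0⇒0<x (0<x*y⇒x#0 0<xy) λ x<0 →
    0≮0 (solve 2 (λ x y → x :* y :+ :- x :* y := con (0 , 0)) refl x y)
      (+-pos 0<xy (*-pos (x<0⇒0<-x x<0) 0<y))

  -- h : k is the ratio in which x divides the unit interval.
  fraction⇒0<h*k : m # 0# → 0# <ᶠ x → x <ᶠ 1# → x * m ≈ h → (1# - x) * m ≈ k → 0# <ᶠ h * k
  fraction⇒0<h*k {m} {x} {h} {k} m#0 0<x x<1 xm≈h [1-x]m≈k =
    0<-resp (begin
      x * (1# - x) * (m * m)    ≈⟨ solve 3 (λ x y m → x :* y :* (m :* m) := x :* m :* (y :* m)) refl x (1# - x) m ⟩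
      x * m * ((1# - x) * m)    ≈⟨ *-cong xm≈h [1-x]m≈k ⟩
      h * k                     ∎)
      (*-pos (*-pos 0<x (x<y⇒0<y-x x<1)) (square-pos m#0))

  -- The witness is `h / (h + k)`. Instead of splitting on the common sign of `h` and `k`, the sum
  -- is multiplied by each of them: `h * (h + k)` and `k * (h + k)` are a square plus `h * k`, hence
  -- positive.
  0<h*k⇒fraction : 0# <ᶠ h * k →
    h + k # 0# × ∃[ x ] 0# <ᶠ x × x <ᶠ 1# × x * (h + k) ≈ h
  0<h*k⇒fraction {h} {k} 0<hk =
    m#0 , h * n , 0<x , 0<y-x⇒x<y 0<1-x , xm≈h
    where
    0<hm : 0# <ᶠ h * (h + k)
    0<hm = 0<-resp (sym (distribˡ h h k)) (+-pos (square-pos (0<x*y⇒x#0 0<hk)) 0<hk)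

    0<km : 0# <ᶠ k * (h + k)
    0<km = 0<-resp (solve 2 (λ h k → h :* k :+ k :* k := k :* (h :+ k)) refl h k)
      (+-pos 0<hk (square-pos (0<x*y⇒y#0 0<hk)))

    m#0 : h + k # 0#
    m#0 = 0<x*y⇒y#0 0<hm

    n : Carrier
    n = proj₁ (inverse m#0)

    xm≈h : h * n * (h + k) ≈ h
    xm≈h = trans (*-assoc h n _) (trans (*-congˡ (proj₂ (inverse m#0))) (*-identityʳ h))

    0<x : 0# <ᶠ h * n
    -- The quotient has the sign of `h * (h + k)`, from which it differs by the positive factor
    -- `(h + k) * (h + k)`.
    0<x = *-pos-cancelʳ (square-pos m#0)
      (0<-resp (trans (*-congʳ (sym xm≈h)) (*-assoc (h * n) (h + k) (h + k))) 0<hm)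

    0<1-x : 0# <ᶠ 1# - h * n
    0<1-x = *-pos-cancelʳ (square-pos m#0) (0<-resp (begin
      k * (h + k)                              ≈⟨ *-congʳ (solve 2 (λ h k → k := (h :+ k) :- h) refl h k) ⟩
      ((h + k) - h) * (h + k)                  ≈⟨ *-congʳ (+-congˡ (-‿cong xm≈h)) ⟨
      ((h + k) - h * n * (h + k)) * (h + k)    ≈⟨ solve 2 (λ x m → (m :- x :* m) :* m := (con (1 , 0) :- x) :* (m :* m)) refl (h * n) (h + k) ⟩
      (1# - h * n) * ((h + k) * (h + k))       ∎) 0<km)

-- Determinants, segments and rays in the plane.

module PlaneProperties {c ℓ₁ ℓ₂ ℓ₃} (F : OrderedField c ℓ₁ ℓ₂ ℓ₃) where

  open OrderedField F
  open OrderedFieldProperties F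
  open Plane F
  open ≈-Reasoning setoid

  private
    variable
      d o p q u v w x y A B P Q : Point
      s t : Carrier

  det-cong : u ≈ₚ v → w ≈ₚ x → det u w ≈ det v x
  det-cong (e₁ , e₂) (f₁ , f₂) = +-cong (*-cong e₁ f₂) (-‿cong (*-cong e₂ f₁))

  ≈ₚ-sym : p ≈ₚ q → q ≈ₚ p
  ≈ₚ-sym (e₁ , e₂) = sym e₁ , sym e₂

  ≈ₚ-trans : p ≈ₚ q → q ≈ₚ o → p ≈ₚ o
  ≈ₚ-trans (e₁ , e₂) (f₁ , f₂) = trans e₁ f₁ , trans e₂ f₂

  -ₚ-congʳ : p ≈ₚ q → p -ₚ o ≈ₚ q -ₚ o
  -ₚ-congʳ (e₁ , e₂) = +-congʳ e₁ , +-congʳ e₂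

  +ₚ-minusˡ : ∀ o u → (o +ₚ u) -ₚ o ≈ₚ u
  +ₚ-minusˡ (o₁ , o₂) (u₁ , u₂) =
    solve 2 (λ o u → (o :+ u) :- o := u) refl o₁ u₁ ,
    solve 2 (λ o u → (o :+ u) :- o := u) refl o₂ u₂

  det-scaleʳ : ∀ t u v → det u (t · v) ≈ t * det u v
  det-scaleʳ t (u₁ , u₂) (v₁ , v₂) =
    solve 5 (λ t u₁ u₂ v₁ v₂ → u₁ :* (t :* v₂) :- u₂ :* (t :* v₁) := t :* (u₁ :* v₂ :- u₂ :* v₁))
      refl t u₁ u₂ v₁ v₂

  det-antisym : ∀ u v → det v u ≈ - det u v
  det-antisym (u₁ , u₂) (v₁ , v₂) =
    solve 4 (λ u₁ u₂ v₁ v₂ → v₁ :* u₂ :- v₂ :* u₁ := :- (u₁ :* v₂ :- u₂ :* v₁)) refl u₁ u₂ v₁ v₂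

  det-self : ∀ u → det u u ≈ 0#
  det-self (u₁ , u₂) = solve 2 (λ u₁ u₂ → u₁ :* u₂ :- u₂ :* u₁ := con (0 , 0)) refl u₁ u₂

  det-reverse : ∀ A B u → det (A -ₚ B) u ≈ - det (B -ₚ A) u
  det-reverse (a₁ , a₂) (b₁ , b₂) (u₁ , u₂) =
    solve 6 (λ a₁ a₂ b₁ b₂ u₁ u₂ →
        (a₁ :- b₁) :* u₂ :- (a₂ :- b₂) :* u₁ := :- ((b₁ :- a₁) :* u₂ :- (b₂ :- a₂) :* u₁))
      refl a₁ a₂ b₁ b₂ u₁ u₂

  det-split : ∀ A B P Q →
    det (P -ₚ A) (Q -ₚ B) ≈ det (B -ₚ A) (P -ₚ A) + det (P -ₚ A) (Q -ₚ A)
  det-split (a₁ , a₂) (b₁ , b₂) (p₁ , p₂) (q₁ , q₂) =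
    solve 8 (λ a₁ a₂ b₁ b₂ p₁ p₂ q₁ q₂ →
        (p₁ :- a₁) :* (q₂ :- b₂) :- (p₂ :- a₂) :* (q₁ :- b₁) :=
        ((b₁ :- a₁) :* (p₂ :- a₂) :- (b₂ :- a₂) :* (p₁ :- a₁)) :+
        ((p₁ :- a₁) :* (q₂ :- a₂) :- (p₂ :- a₂) :* (q₁ :- a₁)))
      refl a₁ a₂ b₁ b₂ p₁ p₂ q₁ q₂

  -- Pairing `p -ₚ A` with `u` kills the term in `t`, since `det u u` vanishes.
  cramer : p ≈ₚ A +ₚ t · u → p ≈ₚ B +ₚ s · w → s * det u w ≈ det (B -ₚ A) u
  cramer {p} {A@(a₁ , a₂)} {t} {u@(u₁ , u₂)} {B@(b₁ , b₂)} {s} {w@(w₁ , w₂)} p≈A+tu p≈B+sw = begin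
    s * det u w
      ≈⟨ solve 9 (λ a₁ a₂ b₁ b₂ u₁ u₂ w₁ w₂ s →
           s :* (u₁ :* w₂ :- u₂ :* w₁) :=
           (u₁ :* ((b₂ :+ s :* w₂) :- a₂) :- u₂ :* ((b₁ :+ s :* w₁) :- a₁)) :+
           ((b₁ :- a₁) :* u₂ :- (b₂ :- a₂) :* u₁))
           refl a₁ a₂ b₁ b₂ u₁ u₂ w₁ w₂ s ⟩
    det u ((B +ₚ s · w) -ₚ A) + det (B -ₚ A) u
      ≈⟨ +-congʳ (det-cong (refl , refl) (-ₚ-congʳ (≈ₚ-trans (≈ₚ-sym p≈B+sw) p≈A+tu))) ⟩
    det u ((A +ₚ t · u) -ₚ A) + det (B -ₚ A) u
      ≈⟨ +-congʳ (det-cong (refl , refl) (+ₚ-minusˡ A (t · u))) ⟩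
    det u (t · u) + det (B -ₚ A) u
      ≈⟨ +-congʳ (trans (det-scaleʳ t u u) (trans (*-congˡ (det-self u)) (zeroʳ t))) ⟩
    0# + det (B -ₚ A) u
      ≈⟨ +-identityˡ _ ⟩
    det (B -ₚ A) u ∎

  -- After multiplication by `m = det u w`, each coordinate is an instance of the expansion of
  -- `A - B` along `u` and `w`: `m (A - B) = det (A - B) w u + det (B - A) u w`. The two hypotheses
  -- are one equation with the roles of the hubs exchanged, hence the opposite determinant in the
  -- second.
  cramer⁻¹ : ∀ A B u w → det u w # 0# →
    s * det u w ≈ det (B -ₚ A) u → t * det w u ≈ det (A -ₚ B) w →
    A +ₚ t · u ≈ₚ B +ₚ s · w
  cramer⁻¹ {s} {t} A@(a₁ , a₂) B@(b₁ , b₂) u@(u₁ , u₂) w@(w₁ , w₂) m#0 sm≈ tm≈ =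
    *-cancelˡ-#0 m#0 (begin
      m * (a₁ + t * u₁)                         ≈⟨ solve 7 (λ a₁ b₁ u₁ u₂ w₁ w₂ t →
                                                     (u₁ :* w₂ :- u₂ :* w₁) :* (a₁ :+ t :* u₁) :=
                                                     (u₁ :* w₂ :- u₂ :* w₁) :* a₁ :- t :* (w₁ :* u₂ :- w₂ :* u₁) :* u₁)
                                                     refl a₁ b₁ u₁ u₂ w₁ w₂ t ⟩
      m * a₁ - t * det w u * u₁                 ≈⟨ +-congˡ (-‿cong (*-congʳ tm≈)) ⟩
      m * a₁ - det (A -ₚ B) w * u₁              ≈⟨ solve 8 (λ a₁ a₂ b₁ b₂ u₁ u₂ w₁ w₂ →
                                                     (u₁ :* w₂ :- u₂ :* w₁) :* a₁ :- ((a₁ :- b₁) :* w₂ :- (a₂ :- b₂) :* w₁) :* u₁ :=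
                                                     (u₁ :* w₂ :- u₂ :* w₁) :* b₁ :+ ((b₁ :- a₁) :* u₂ :- (b₂ :- a₂) :* u₁) :* w₁)
                                                     refl a₁ a₂ b₁ b₂ u₁ u₂ w₁ w₂ ⟩
      m * b₁ + det (B -ₚ A) u * w₁              ≈⟨ +-congˡ (*-congʳ sm≈) ⟨
      m * b₁ + s * m * w₁                       ≈⟨ solve 4 (λ m b s w → m :* b :+ s :* m :* w := m :* (b :+ s :* w)) refl m b₁ s w₁ ⟩
      m * (b₁ + s * w₁)                         ∎) ,
    *-cancelˡ-#0 m#0 (begin
      m * (a₂ + t * u₂)                         ≈⟨ solve 7 (λ a₂ b₂ u₁ u₂ w₁ w₂ t →
                                                     (u₁ :* w₂ :- u₂ :* w₁) :* (a₂ :+ t :* u₂) :=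
                                                     (u₁ :* w₂ :- u₂ :* w₁) :* a₂ :- t :* (w₁ :* u₂ :- w₂ :* u₁) :* u₂)
                                                     refl a₂ b₂ u₁ u₂ w₁ w₂ t ⟩
      m * a₂ - t * det w u * u₂                 ≈⟨ +-congˡ (-‿cong (*-congʳ tm≈)) ⟩
      m * a₂ - det (A -ₚ B) w * u₂              ≈⟨ solve 8 (λ a₁ a₂ b₁ b₂ u₁ u₂ w₁ w₂ →
                                                     (u₁ :* w₂ :- u₂ :* w₁) :* a₂ :- ((a₁ :- b₁) :* w₂ :- (a₂ :- b₂) :* w₁) :* u₂ :=
                                                     (u₁ :* w₂ :- u₂ :* w₁) :* b₂ :+ ((b₁ :- a₁) :* u₂ :- (b₂ :- a₂) :* u₁) :* w₂)
                                                     refl a₁ a₂ b₁ b₂ u₁ u₂ w₁ w₂ ⟩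
      m * b₂ + det (B -ₚ A) u * w₂              ≈⟨ +-congˡ (*-congʳ sm≈) ⟨
      m * b₂ + s * m * w₂                       ≈⟨ solve 4 (λ m b s w → m :* b :+ s :* m :* w := m :* (b :+ s :* w)) refl m b₂ s w₂ ⟩
      m * (b₂ + s * w₂)                         ∎)
    where
    m : Carrier
    m = det u w

  interiorTo-reverse : InteriorTo p x y → InteriorTo p y x
  interiorTo-reverse {p} {x₁ , x₂} {y₁ , y₂} (t , 0<t , t<1 , p₁≈ , p₂≈) =
    1# - t , x<y⇒0<y-x t<1 ,
    0<y-x⇒x<y (0<-resp (solve 1 (λ t → t := con (1 , 0) :- (con (1 , 0) :- t)) refl t) 0<t) ,
    trans p₁≈ (reverse x₁ y₁) , trans p₂≈ (reverse x₂ y₂)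
    where
    reverse : ∀ x y → x + t * (y - x) ≈ y + (1# - t) * (x - y)
    reverse x y = solve 3 (λ x y t → x :+ t :* (y :- x) := y :+ (con (1 , 0) :- t) :* (x :- y)) refl x y t

  -- The determinant `m` of the two directions splits as `h + k`, and Cramer's rule gives
  -- `s * m ≈ h`: the meeting point divides `BQ` in the ratio `h : k`. As it is interior, `h * k` is
  -- positive.
  segmentsMeet⇒smallerAngle : det (B -ₚ A) (P -ₚ A) # 0# →
    InteriorTo p A P → InteriorTo p B Q → SmallerAngle (B -ₚ A) (P -ₚ A) (Q -ₚ A)
  segmentsMeet⇒smallerAngle {B} {A} {P} {p} {Q} h#0 (t , _ , _ , p≈A) (s , 0<s , s<1 , p≈B) =
    fraction⇒0<h*k (x*y#0⇒y#0 (#0-resp (sym sm≈h) h#0)) 0<s s<1 sm≈h (begin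
      (1# - s) * m       ≈⟨ solve 2 (λ s m → (con (1 , 0) :- s) :* m := m :- s :* m) refl s m ⟩
      m - s * m          ≈⟨ +-cong (det-split A B P Q) (-‿cong sm≈h) ⟩
      (h + k) - h        ≈⟨ solve 2 (λ h k → (h :+ k) :- h := k) refl h k ⟩
      k                  ∎)
    where
    m h k : Carrier
    m = det (P -ₚ A) (Q -ₚ B)
    h = det (B -ₚ A) (P -ₚ A)
    k = det (P -ₚ A) (Q -ₚ A)

    sm≈h : s * m ≈ h
    sm≈h = cramer p≈A p≈B

  smallerAngle⇒parameter : ∀ A B P Q → SmallerAngle (B -ₚ A) (P -ₚ A) (Q -ₚ A) →
    det (P -ₚ A) (Q -ₚ B) # 0# ×
    ∃[ s ] 0# <ᶠ s × s <ᶠ 1# × s * det (P -ₚ A) (Q -ₚ B) ≈ det (B -ₚ A) (P -ₚ A)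
  smallerAngle⇒parameter A B P Q angle =
    let m#0 , s , 0<s , s<1 , sm≈ = 0<h*k⇒fraction angle
    in #0-resp (sym (det-split A B P Q)) m#0 ,
       s , 0<s , s<1 , trans (*-congˡ (det-split A B P Q)) sm≈

  -- The angles at one hub place the meeting point within the segment from the other hub: `angleA`
  -- yields `s` on `BQ`, `angleB` yields `t` on `AP`. Both parameters solve Cramer's equations, so
  -- they name the same point.
  smallerAngles⇒segmentsMeet : ∀ A B P Q →
    SmallerAngle (B -ₚ A) (P -ₚ A) (Q -ₚ A) → SmallerAngle (A -ₚ B) (Q -ₚ B) (P -ₚ B) →
    ∃[ p ] InteriorTo p A P × InteriorTo p B Q
  smallerAngles⇒segmentsMeet A B P Q angleA angleB =
    let m#0 , s , 0<s , s<1 , sm≈ = smallerAngle⇒parameter A B P Q angleA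
        _   , t , 0<t , t<1 , tm≈ = smallerAngle⇒parameter B A Q P angleB
    in A +ₚ t · (P -ₚ A) ,
       (t , 0<t , t<1 , (refl , refl)) ,
       (s , 0<s , s<1 , cramer⁻¹ A B (P -ₚ A) (Q -ₚ B) m#0 sm≈ tm≈)

  -- Cramer's rule with both origins equal to `o` makes `s` times the determinant zero, although `s`
  -- is positive and the determinant apart from zero.
  concurrentSegments-disjoint : det (P -ₚ o) (Q -ₚ o) # 0# →
    InteriorTo p o P → ¬ InteriorTo p o Q
  concurrentSegments-disjoint {P} {o} {Q} {p} c#0 (_ , _ , _ , p≈) (s , 0<s , _ , p≈′) = 0≮0 sc²≈0
    (*-pos 0<s (square-pos c#0))
    where
    c₀ : Carrier
    c₀ = det (P -ₚ o) (Q -ₚ o)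
    sc²≈0 : s * (c₀ * c₀) ≈ 0#
    sc²≈0 = begin
      s * (c₀ * c₀)                 ≈⟨ *-assoc s c₀ c₀ ⟨
      s * c₀ * c₀                   ≈⟨ *-congʳ (cramer p≈ p≈′) ⟩
      det (o -ₚ o) (P -ₚ o) * c₀    ≈⟨ solve 5 (λ o₁ o₂ u₁ u₂ c → ((o₁ :- o₁) :* u₂ :- (o₂ :- o₂) :* u₁) :* c := con (0 , 0))
                                          refl (proj₁ o) (proj₂ o) (proj₁ (P -ₚ o)) (proj₂ (P -ₚ o)) c₀ ⟩
      0#                            ∎

  smallerAngle-irrefl : ∀ d u → ¬ SmallerAngle d u u
  smallerAngle-irrefl d u = 0≮0 (trans (*-congˡ (det-self u)) (zeroʳ _))

  -- Multiplying the two angle conditions gives `- k * k` times the positive `sameSide` product, so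
  -- `- k * k` and the square `k * k` would both be positive.
  smallerAngle-asym : 0# <ᶠ det d u * det d v → SmallerAngle d u v → ¬ SmallerAngle d v u
  smallerAngle-asym {d} {u} {v} sameSide uv vu = 0≮0 (begin
    k * k + - k * k                        ≈⟨ solve 1 (λ k → k :* k :+ :- k :* k := con (0 , 0)) refl k ⟩
    0#                                     ∎)
    (+-pos (square-pos (0<x*y⇒y#0 uv)) (*-pos-cancelʳ sameSide (0<-resp (begin
      det d u * k * (det d v * det v u)      ≈⟨ *-congˡ (*-congˡ (det-antisym u v)) ⟩
      det d u * k * (det d v * - k)          ≈⟨ solve 3 (λ x y k → x :* k :* (y :* :- k) := :- k :* k :* (x :* y)) refl (det d u) (det d v) k ⟩
      - k * k * (det d u * det d v)          ∎) (*-pos uv vu))))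
    where
    k : Carrier
    k = det u v

  onRay-offset : p ≈ₚ o +ₚ t · u → p -ₚ o ≈ₚ t · u
  onRay-offset {o = o} p≈ = ≈ₚ-trans (-ₚ-congʳ p≈) (+ₚ-minusˡ o _)

  det-onRay : ∀ d → p ≈ₚ o +ₚ t · u → det d (p -ₚ o) ≈ t * det d u
  det-onRay {t = t} {u = u} d p≈ =
    trans (det-cong (refl , refl) (onRay-offset p≈)) (det-scaleʳ t d u)

  det-onRays : p ≈ₚ o +ₚ t · u → q ≈ₚ o +ₚ s · v → det (p -ₚ o) (q -ₚ o) ≈ t * s * det u v
  det-onRays {p} {o} {t} {u} {q} {s} {v} p≈ q≈ = begin
    det (p -ₚ o) (q -ₚ o)       ≈⟨ det-onRay (p -ₚ o) q≈ ⟩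
    s * det (p -ₚ o) v          ≈⟨ *-congˡ (det-antisym v (p -ₚ o)) ⟩
    s * - det v (p -ₚ o)        ≈⟨ *-congˡ (-‿cong (det-onRay v p≈)) ⟩
    s * - (t * det v u)         ≈⟨ *-congˡ (-‿cong (*-congˡ (det-antisym u v))) ⟩
    s * - (t * - det u v)       ≈⟨ solve 3 (λ s t k → s :* :- (t :* :- k) := t :* s :* k) refl s t (det u v) ⟩
    t * s * det u v             ∎

  -- Genericity is not enough to make the parameter of a point on a ray positive:
  -- constructively, t ≉ 0# is weaker than t # 0#.  A second, transversal ray through
  -- the point provides the apartness.
  onRay⇒0<t : p ≈ₚ A +ₚ t · u → p ≈ₚ B +ₚ s · w → ¬ (t <ᶠ 0#) → det (A -ₚ B) w # 0# → 0# <ᶠ t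
  onRay⇒0<t p≈A p≈B t≮0 h#0 = x#0∧x≮0⇒0<x (x*y#0⇒x#0 (#0-resp (sym (cramer p≈B p≈A)) h#0)) t≮0

  -- One hub `o` with its rays, indexed by label; `d` points to the other hub, and `rank` is the
  -- place of a ray in the angular order. At `a` the rank is the inverse of `π`, at `b` it is the
  -- identity. Stating `sameSide` by a positive product treats both sides of the line at once.
  module Fan {n} (o d : Point) (ray vertex : Fin n → Point) (rank : Fin n → Fin n)
    (rank-injective : ∀ {i j} → rank i ≡ rank j → i ≡ j)
    (sameSide : ∀ i j → 0# <ᶠ det d (ray i) * det d (ray j))
    (onRay : ∀ i → ∃[ t ] 0# <ᶠ t × vertex i ≈ₚ o +ₚ t · ray i)
    (increasing : ∀ {i j} → rank i < rank j → SmallerAngle d (ray i) (ray j))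
    where

    private
      variable
        i j : Fin n

    vertices-sameSide : ∀ i j → 0# <ᶠ det d (vertex i -ₚ o) * det d (vertex j -ₚ o)
    vertices-sameSide i j =
      let t , 0<t , vᵢ≈ = onRay i
          s , 0<s , vⱼ≈ = onRay j
      in 0<-resp (begin
        t * s * (det d (ray i) * det d (ray j))              ≈⟨ solve 4 (λ t s x y → t :* s :* (x :* y) := t :* x :* (s :* y)) refl t s (det d (ray i)) (det d (ray j)) ⟩
        t * det d (ray i) * (s * det d (ray j))              ≈⟨ *-cong (det-onRay d vᵢ≈) (det-onRay d vⱼ≈) ⟨
        det d (vertex i -ₚ o) * det d (vertex j -ₚ o)        ∎)
        (*-pos (*-pos 0<t 0<s) (sameSide i j))

    vertex-offLine : ∀ i → det d (vertex i -ₚ o) # 0#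
    vertex-offLine i = 0<x*y⇒x#0 (vertices-sameSide i i)

    rank<⇒smallerAngle : rank i < rank j → SmallerAngle d (vertex i -ₚ o) (vertex j -ₚ o)
    rank<⇒smallerAngle {i} {j} i<j =
      let t , 0<t , vᵢ≈ = onRay i
          s , 0<s , vⱼ≈ = onRay j
      in 0<-resp (begin
        t * (t * s) * (det d (ray i) * det (ray i) (ray j))      ≈⟨ solve 4 (λ t s x y → t :* (t :* s) :* (x :* y) := t :* x :* (t :* s :* y)) refl t s (det d (ray i)) (det (ray i) (ray j)) ⟩
        t * det d (ray i) * (t * s * det (ray i) (ray j))        ≈⟨ *-cong (det-onRay d vᵢ≈) (det-onRays vᵢ≈ vⱼ≈) ⟨
        det d (vertex i -ₚ o) * det (vertex i -ₚ o) (vertex j -ₚ o)   ∎)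
        (*-pos (*-pos 0<t (*-pos 0<t 0<s)) (increasing i<j))

    -- Trichotomy of the ranks stands in for trichotomy of the field: equal or reversed ranks
    -- contradict irreflexivity or asymmetry of the angle comparison.
    smallerAngle⇒rank< : SmallerAngle d (vertex i -ₚ o) (vertex j -ₚ o) → rank i < rank j
    smallerAngle⇒rank< {i} {j} angle with <-cmp (rank i) (rank j)
    ... | tri< i<j _ _ = i<j
    ... | tri≈ _ i≡j _ with ≡.refl ← rank-injective i≡j =
      contradiction angle (smallerAngle-irrefl d (vertex i -ₚ o))
    ... | tri> _ _ j<i =
      contradiction (rank<⇒smallerAngle j<i) (smallerAngle-asym {d} (vertices-sameSide i j) angle)

    directions-apart : i ≢ j → det (vertex i -ₚ o) (vertex j -ₚ o) # 0#
    directions-apart {i} {j} i≢j with <-cmp (rank i) (rank j)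
    ... | tri< i<j _ _ = 0<x*y⇒y#0 (rank<⇒smallerAngle i<j)
    ... | tri≈ _ i≡j _ = contradiction (rank-injective i≡j) i≢j
    -- The determinant is known to be apart from zero only in the reversed order; written as `- 1#`
    -- times the wanted one, it passes its apartness to that factor.
    ... | tri> _ _ j<i = x*y#0⇒y#0 (#0-resp
      (trans (det-antisym (vertex i -ₚ o) (vertex j -ₚ o)) (solve 1 (λ x → :- x := :- con (1 , 0) :* x) refl _))
      (0<x*y⇒y#0 (rank<⇒smallerAngle j<i)))

    edges-disjoint : i ≢ j → ¬ (∃[ p ] InteriorTo p o (vertex i) × InteriorTo p o (vertex j))
    edges-disjoint i≢j (p , p∈i , p∈j) =
      concurrentSegments-disjoint (directions-apart i≢j) p∈i p∈j

-- Crossings in a realization.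

module RealizationProperties {c ℓ₁ ℓ₂ ℓ₃} (F : OrderedField c ℓ₁ ℓ₂ ℓ₃)
  {n} {π : Permutation′ n} (K : Plane.Realization F π) where

  open OrderedField F
  open Plane F
  open OrderedFieldProperties F
  open PlaneProperties F
  open ≈-Reasoning setoid

  open Realization K

  private
    -- Reindexes the rays from `A` by label: the ray in place `k` carries the label `π ⟨$⟩ʳ k`.
    rayTo : Fin n → Point
    rayTo i = rayA (π ⟨$⟩ˡ i)

    sameSide : (∀ k → 0# <ᶠ det (B -ₚ A) (rayTo k)) × (∀ k → 0# <ᶠ det (B -ₚ A) (rayB k))
             ⊎ (∀ k → det (B -ₚ A) (rayTo k) <ᶠ 0#) × (∀ k → det (B -ₚ A) (rayB k) <ᶠ 0#)
    sameSide = [ (λ (a⁺ , b⁺) → inj₁ (a⁺ ∘ (π ⟨$⟩ˡ_) , b⁺))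
               , (λ (a⁻ , b⁻) → inj₂ (a⁻ ∘ (π ⟨$⟩ˡ_) , b⁻)) ]′ oneSide

    sameSideA : ∀ i j → 0# <ᶠ det (B -ₚ A) (rayTo i) * det (B -ₚ A) (rayTo j)
    sameSideA i j = [ (λ (a⁺ , _) → *-pos (a⁺ i) (a⁺ j)) , (λ (a⁻ , _) → *-neg (a⁻ i) (a⁻ j)) ]′ sameSide

    sameSideB : ∀ i j → 0# <ᶠ det (A -ₚ B) (rayB i) * det (A -ₚ B) (rayB j)
    sameSideB i j = 0<-resp (begin
      det (B -ₚ A) (rayB i) * det (B -ₚ A) (rayB j)                      ≈⟨ solve 2 (λ x y → x :* y := :- x :* :- y) refl _ _ ⟩
      - det (B -ₚ A) (rayB i) * - det (B -ₚ A) (rayB j)                  ≈⟨ *-cong (det-reverse A B (rayB i)) (det-reverse A B (rayB j)) ⟨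
      det (A -ₚ B) (rayB i) * det (A -ₚ B) (rayB j)        ∎)
      ([ (λ (_ , b⁺) → *-pos (b⁺ i) (b⁺ j)) , (λ (_ , b⁻) → *-neg (b⁻ i) (b⁻ j)) ]′ sameSide)

    vertexOnRayTo : ∀ i → OnRay (vertex i) A (rayTo i)
    vertexOnRayTo i =
      ≡.subst (λ j → OnRay (vertex j) A (rayTo i)) (inverseʳ π) (vertexOnA (π ⟨$⟩ˡ i))

    onRayA : ∀ i → ∃[ t ] 0# <ᶠ t × vertex i ≈ₚ A +ₚ t · rayTo i
    onRayA i =
      let t , t≮0 , v≈A = vertexOnRayTo i
          s , s≮0 , v≈B = vertexOnB i
      in t , onRay⇒0<t v≈A v≈B t≮0 (0<x*y⇒x#0 (sameSideB i i)) , v≈A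

    onRayB : ∀ i → ∃[ t ] 0# <ᶠ t × vertex i ≈ₚ B +ₚ t · rayB i
    onRayB i =
      let t , t≮0 , v≈A = vertexOnRayTo i
          s , s≮0 , v≈B = vertexOnB i
      in s , onRay⇒0<t v≈B v≈A s≮0 (0<x*y⇒x#0 (sameSideA i i)) , v≈B

    ˡ-injective : ∀ {i j} → π ⟨$⟩ˡ i ≡ π ⟨$⟩ˡ j → i ≡ j
    ˡ-injective eq = ≡.trans (≡.sym (inverseʳ π)) (≡.trans (≡.cong (π ⟨$⟩ʳ_) eq) (inverseʳ π))

    module FanA = Fan A (B -ₚ A) rayTo vertex (π ⟨$⟩ˡ_) ˡ-injective sameSideA onRayA increasingA
    module FanB = Fan B (A -ₚ B) rayB vertex id id sameSideB onRayB increasingB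

    open GeometricGraph (K̄₂ K) using (Crosses)

  crosses⇔inversion : ∀ i j → Crosses a (mid i) b (mid j) ⇔ E π j i
  crosses⇔inversion i j = mk⇔ to from
    where
    to : Crosses a (mid i) b (mid j) → E π j i
    to (_ , _ , _ , p , p∈i , p∈j) =
      -- Seen from `B` the two segments change roles, so this compares the labels as `j < i`; the
      -- comparison at `A` is between their images under the inverse of `π`.
      FanB.smallerAngle⇒rank< (segmentsMeet⇒smallerAngle (FanB.vertex-offLine j) p∈j p∈i) ,
      FanA.smallerAngle⇒rank< (segmentsMeet⇒smallerAngle (FanA.vertex-offLine i) p∈i p∈j)

    from : E π j i → Crosses a (mid i) b (mid j)
    from (j<i , i<j) =
      _ , _ , (λ { (inj₁ (() , _)) ; (inj₂ (() , _)) }) ,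
      smallerAngles⇒segmentsMeet A B (vertex i) (vertex j)
        (FanA.rank<⇒smallerAngle i<j) (FanB.rank<⇒smallerAngle j<i)

  crosses-reverse : ∀ {x y u v} → Crosses x y u v → Crosses y x u v
  crosses-reverse {x} {y} (xy , uv , xy≢uv , p , p∈xy , p∈uv) =
    SimpleGraph.sym (K₂, n) {x} {y} xy , uv ,
    (λ { (inj₁ (y≡u , x≡v)) → xy≢uv (inj₂ (x≡v , y≡u))
       ; (inj₂ (y≡v , x≡u)) → xy≢uv (inj₁ (x≡u , y≡v)) }) ,
    p , interiorTo-reverse p∈xy , p∈uv

  crosses-swap : ∀ {x y u v} → Crosses x y u v → Crosses u v x y
  crosses-swap (xy , uv , xy≢uv , p , p∈xy , p∈uv) =
    uv , xy ,
    (λ { (inj₁ (≡.refl , ≡.refl)) → xy≢uv (inj₁ (≡.refl , ≡.refl))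
       ; (inj₂ (≡.refl , ≡.refl)) → xy≢uv (inj₂ (≡.refl , ≡.refl)) }) ,
    p , p∈uv , p∈xy

  ¬crosses-a : ∀ {i j} → ¬ Crosses a (mid i) a (mid j)
  ¬crosses-a (_ , _ , i≢j , p) = FanA.edges-disjoint (λ { ≡.refl → i≢j (inj₁ (≡.refl , ≡.refl)) }) p

  ¬crosses-b : ∀ {i j} → ¬ Crosses b (mid i) b (mid j)
  ¬crosses-b (_ , _ , i≢j , p) = FanB.edges-disjoint (λ { ≡.refl → i≢j (inj₁ (≡.refl , ≡.refl)) }) p

  -- An elimination principle: reversing an edge and swapping the two edges bring every crossing to
  -- the form `a (mid i)`, `b (mid j)`, where it is an inversion.
  module _ {ℓ} (P : (x y u v : K₂Vertex n) → Set ℓ)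
    (P-reverse : ∀ {x y u v} → P x y u v → P y x u v)
    (P-swap : ∀ {x y u v} → P x y u v → P u v x y)
    (P-inversion : ∀ {i j} → E π j i → P a (mid i) b (mid j))
    where

    private
      fromHubs : ∀ {x i y j} → K₂Adj x (mid i) → K₂Adj y (mid j) →
        Crosses x (mid i) y (mid j) → P x (mid i) y (mid j)
      fromHubs {a} {i} {a} {j} _ _ cr = contradiction cr ¬crosses-a
      fromHubs {a} {i} {b} {j} _ _ cr = P-inversion (Equivalence.to (crosses⇔inversion i j) cr)
      fromHubs {b} {i} {a} {j} _ _ cr = P-swap (P-inversion (Equivalence.to (crosses⇔inversion j i) (crosses-swap cr)))
      fromHubs {b} {i} {b} {j} _ _ cr = contradiction cr ¬crosses-b

      reverseˡ : ∀ {x y u v} → (Crosses y x u v → P y x u v) → Crosses x y u v → P x y u v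
      reverseˡ f = P-reverse ∘ f ∘ crosses-reverse

      swapped : ∀ {x y u v} → (Crosses u v x y → P u v x y) → Crosses x y u v → P x y u v
      swapped f = P-swap ∘ f ∘ crosses-swap

      fromHub : ∀ {x i u v} → K₂Adj x (mid i) → K₂Adj u v →
        Crosses x (mid i) u v → P x (mid i) u v
      fromHub {u = u}     {v = mid j} xi uj = fromHubs xi uj
      -- `P-reverse` turns only the first edge, so the second is brought to the front, turned and
      -- put back.
      fromHub {u = mid j} {v = a}     xi _  = swapped (reverseˡ (swapped (fromHubs xi _)))
      fromHub {u = mid j} {v = b}     xi _  = swapped (reverseˡ (swapped (fromHubs xi _)))

      oriented : ∀ {x y u v} → K₂Adj x y → K₂Adj u v → Crosses x y u v → P x y u v
      oriented {x}     {mid i} xi uv = fromHub xi uv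
      oriented {mid i} {a}     _  uv = reverseˡ (fromHub _ uv)
      oriented {mid i} {b}     _  uv = reverseˡ (fromHub _ uv)

    crosses-elim : ∀ {x y u v} → Crosses x y u v → P x y u v
    crosses-elim cr@(xy , uv , _) = oriented xy uv cr

-- Symmetries of the complete bipartite graph.

K₂Symmetry : ℕ → Set
K₂Symmetry n = K₂Vertex n ↔ K₂Vertex n

mid-injective : ∀ {n} {i j : Fin n} → mid i ≡ mid j → i ≡ j
mid-injective ≡.refl = ≡.refl

keepHubs exchangeHubs : ∀ {n} → Fin n ↔ Fin n → K₂Symmetry n
keepHubs g = mk↔ₛ′ (lift g.to) (lift g.from)
  (λ { a → ≡.refl ; b → ≡.refl ; (mid i) → ≡.cong mid (g.strictlyInverseˡ i) })
  (λ { a → ≡.refl ; b → ≡.refl ; (mid i) → ≡.cong mid (g.strictlyInverseʳ i) })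
  where
  module g = Inverse g
  lift : ∀ {n} → (Fin n → Fin n) → K₂Vertex n → K₂Vertex n
  lift f a       = a
  lift f b       = b
  lift f (mid i) = mid (f i)
exchangeHubs g = mk↔ₛ′ (lift g.to) (lift g.from)
  (λ { a → ≡.refl ; b → ≡.refl ; (mid i) → ≡.cong mid (g.strictlyInverseˡ i) })
  (λ { a → ≡.refl ; b → ≡.refl ; (mid i) → ≡.cong mid (g.strictlyInverseʳ i) })
  where
  module g = Inverse g
  lift : ∀ {n} → (Fin n → Fin n) → K₂Vertex n → K₂Vertex n
  lift f a       = b
  lift f b       = a
  lift f (mid i) = mid (f i)

data Hub {n} : K₂Vertex n → Set where
  a : Hub a
  b : Hub b

hub-adjacent : ∀ {n} {h : K₂Vertex n} → Hub h → ∀ i → K₂Adj h (mid i)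
hub-adjacent a i = _
hub-adjacent b i = _

hub-neighbour : ∀ {n} {h y : K₂Vertex n} → Hub h → K₂Adj h y → ∃[ i ] y ≡ mid i
hub-neighbour {y = mid i} a _ = i , ≡.refl
hub-neighbour {y = mid i} b _ = i , ≡.refl

mid-neighbour : ∀ {n} {i : Fin n} {y} → K₂Adj (mid i) y → Hub y
mid-neighbour {y = a} _ = a
mid-neighbour {y = b} _ = b

hub-or-mid : ∀ {n} (x : K₂Vertex n) → Hub x ⊎ ∃[ i ] x ≡ mid i
hub-or-mid a       = inj₁ a
hub-or-mid b       = inj₁ b
hub-or-mid (mid i) = inj₂ (i , ≡.refl)

hubs-pigeonhole : ∀ {n} {x y z : K₂Vertex n} → Hub x → Hub y → Hub z → x ≡ y ⊎ y ≡ z ⊎ x ≡ z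
hubs-pigeonhole a a _ = inj₁ ≡.refl
hubs-pigeonhole b b _ = inj₁ ≡.refl
hubs-pigeonhole a b b = inj₂ (inj₁ ≡.refl)
hubs-pigeonhole b a a = inj₂ (inj₁ ≡.refl)
hubs-pigeonhole a b a = inj₂ (inj₂ ≡.refl)
hubs-pigeonhole b a b = inj₂ (inj₂ ≡.refl)

distinct-hubs : ∀ {n} {x y : K₂Vertex n} → Hub x → Hub y → x ≢ y → (x ≡ a × y ≡ b) ⊎ (x ≡ b × y ≡ a)
distinct-hubs a a x≢y = contradiction ≡.refl x≢y
distinct-hubs a b _   = inj₁ (≡.refl , ≡.refl)
distinct-hubs b a _   = inj₂ (≡.refl , ≡.refl)
distinct-hubs b b x≢y = contradiction ≡.refl x≢y

module Automorphism {n} (φ : K₂Symmetry n)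
  (adjacent⇔ : ∀ u v → K₂Adj u v ⇔ K₂Adj (Inverse.to φ u) (Inverse.to φ v)) where

  open Inverse φ

  to-injective : ∀ {x y} → to x ≡ to y → x ≡ y
  to-injective {x} {y} eq =
    ≡.trans (≡.sym (strictlyInverseʳ x)) (≡.trans (≡.cong from eq) (strictlyInverseʳ y))

  to-adjacent : ∀ u v → K₂Adj u v → K₂Adj (to u) (to v)
  to-adjacent u v = Equivalence.to (adjacent⇔ u v)

  -- The middle vertices are exactly the neighbours of any hub. If `a` goes to a hub, they are
  -- therefore permuted among themselves, which leaves only a hub as the image of `b`.
  module _ (a-hub : Hub (to a)) where

    to-mid : ∀ i → ∃[ j ] to (mid i) ≡ mid j
    to-mid i = hub-neighbour a-hub (to-adjacent a (mid i) _)

    from-mid : ∀ i → ∃[ j ] from (mid i) ≡ mid j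
    from-mid i = hub-neighbour a (Equivalence.from (adjacent⇔ a (from (mid i)))
      (≡.subst (K₂Adj (to a)) (≡.sym (strictlyInverseˡ (mid i))) (hub-adjacent a-hub i)))

    mids : Fin n ↔ Fin n
    mids = mk↔ₛ′ (proj₁ ∘ to-mid) (proj₁ ∘ from-mid)
      (λ i → mid-injective (≡.trans (≡.sym (proj₂ (to-mid _)))
        (≡.trans (≡.cong to (≡.sym (proj₂ (from-mid i)))) (strictlyInverseˡ (mid i)))))
      (λ i → mid-injective (≡.trans (≡.sym (proj₂ (from-mid _)))
        (≡.trans (≡.cong from (≡.sym (proj₂ (to-mid i)))) (strictlyInverseʳ (mid i)))))

    b-hub : Hub (to b)
    b-hub with hub-or-mid (to b)
    ... | inj₁ hub = hub
    ... | inj₂ (j , eq) with from-mid j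
    ...   | k , eq′ with ≡.trans (≡.sym (strictlyInverseʳ b)) (≡.trans (≡.cong from eq) eq′)
    ...     | ()

    hubs-image : (to a ≡ a × to b ≡ b) ⊎ (to a ≡ b × to b ≡ a)
    hubs-image = distinct-hubs a-hub b-hub (λ eq → contradiction (to-injective eq) λ ())

-- If `a` went to a middle vertex, its neighbours would go injectively to the two hubs; three of
-- them are already too many.
a-hub : ∀ {n} (φ : K₂Symmetry (3 ℕ.+ n)) →
  (∀ u v → K₂Adj u v ⇔ K₂Adj (Inverse.to φ u) (Inverse.to φ v)) → Hub (Inverse.to φ a)
a-hub {n} φ adjacent⇔ with hub-or-mid (Inverse.to φ a)
... | inj₁ hub = hub
... | inj₂ (i , eq) with hubs-pigeonhole (hub zero) (hub (suc zero)) (hub (suc (suc zero)))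
  where
  hub : ∀ k → Hub (Inverse.to φ (mid k))
  hub k = mid-neighbour (≡.subst (λ x → K₂Adj x (Inverse.to φ (mid k))) eq (Equivalence.to (adjacent⇔ a (mid k)) _))
...   | inj₁ eq₀₁ with () ← Automorphism.to-injective φ adjacent⇔ eq₀₁
...   | inj₂ (inj₁ eq₁₂) with () ← Automorphism.to-injective φ adjacent⇔ eq₁₂
...   | inj₂ (inj₂ eq₀₂) with () ← Automorphism.to-injective φ adjacent⇔ eq₀₂

-- Used with the identity and a round trip of a bijection as `f` and `g`, in either order; pointwise
-- equality avoids function extensionality.
resp₄ : ∀ {ℓ} {V : Set} (P : V → V → V → V → Set ℓ) {f g : V → V} → (∀ x → f x ≡ g x) →
  ∀ {x y u v} → P (f x) (f y) (f u) (f v) → P (g x) (g y) (g u) (g v)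
resp₄ P {f} {g} f≗g {x} {y} {u} {v} p =
  ≡.subst₂ (λ x y → P x y (g u) (g v)) (f≗g x) (f≗g y)
    (≡.subst₂ (P (f x) (f y)) (f≗g u) (f≗g v) p)

-- The inverse of `flip π` is `π`, which takes the two arguments back to the labels `j` and `i`; the
-- two comparisons that make up an inversion merely trade places.
E-flip : ∀ {n} (π : Permutation′ n) i j → E π i j ⇔ E (flip π) (π ⟨$⟩ˡ j) (π ⟨$⟩ˡ i)
E-flip π i j = mk⇔
  (λ (i<j , π⁻¹j<π⁻¹i) → π⁻¹j<π⁻¹i , ≡.subst₂ _<_ (≡.sym (inverseʳ π)) (≡.sym (inverseʳ π)) i<j)
  (λ (π⁻¹j<π⁻¹i , i<j) → ≡.subst₂ _<_ (inverseʳ π) (inverseʳ π) i<j , π⁻¹j<π⁻¹i)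

<-unique-Fin2 : ∀ {i j k l : Fin 2} → i < j → k < l → i ≡ k × j ≡ l
<-unique-Fin2 {zero}     {suc zero} {zero}     {suc zero} _ _ = ≡.refl , ≡.refl
<-unique-Fin2 {suc zero} {suc zero} (ℕ.s≤s ())
<-unique-Fin2 {zero} {suc zero} {suc zero} {suc zero} _ (ℕ.s≤s ())

-- Geo-isomorphisms against isomorphisms of inversion digraphs.

module _ {c ℓ₁ ℓ₂ ℓ₃} (F : OrderedField c ℓ₁ ℓ₂ ℓ₃) {n} {π σ : Permutation′ n}
  (Kσ : Plane.Realization F σ) (Kπ : Plane.Realization F π) where

  open Plane F

  private
    module σ = RealizationProperties F Kσ
    module π = RealizationProperties F Kπ
    open GeometricGraph (K̄₂ Kσ) using () renaming (Crosses to Crossesσ)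
    open GeometricGraph (K̄₂ Kπ) using () renaming (Crosses to Crossesπ)

  -- By `crosses-elim` each direction has to be checked on inversions only. The backward one ends at
  -- vertices of the form `from (to x)`, which `resp₄` simplifies.
  symmetry⇒geoIsomorphic : (φ : K₂Symmetry n) → let open Inverse φ in
    (∀ u v → K₂Adj u v ⇔ K₂Adj (to u) (to v)) →
    (∀ {i j} → E σ j i → Crossesπ (to a) (to (mid i)) (to b) (to (mid j))) →
    (∀ {i j} → E π j i → Crossesσ (from a) (from (mid i)) (from b) (from (mid j))) →
    GeoIsomorphic (K̄₂ Kσ) (K̄₂ Kπ)
  symmetry⇒geoIsomorphic φ adjacent⇔ σ⇒π π⇒σ = φ , adjacent⇔ , λ x y u v → mk⇔
    (σ.crosses-elim (λ x y u v → Crossesπ (to x) (to y) (to u) (to v))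
      π.crosses-reverse π.crosses-swap σ⇒π)
    (resp₄ Crossesσ strictlyInverseʳ ∘
      π.crosses-elim (λ x y u v → Crossesσ (from x) (from y) (from u) (from v))
        σ.crosses-reverse σ.crosses-swap π⇒σ)
    where open Inverse φ

  D≅⇒geoIsomorphic : D σ ≅ D π → GeoIsomorphic (K̄₂ Kσ) (K̄₂ Kπ)
  D≅⇒geoIsomorphic (g , arcs) = symmetry⇒geoIsomorphic (keepHubs g)
    (λ { a a → ⇔-id _ ; a b → ⇔-id _ ; a (mid _) → ⇔-id _
       ; b a → ⇔-id _ ; b b → ⇔-id _ ; b (mid _) → ⇔-id _
       ; (mid _) a → ⇔-id _ ; (mid _) b → ⇔-id _ ; (mid _) (mid _) → ⇔-id _ })
    (λ {i} {j} inv → Equivalence.from (π.crosses⇔inversion _ _) (Equivalence.to (arcs j i) inv))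
    (λ {i} {j} inv → Equivalence.from (σ.crosses⇔inversion _ _) (Equivalence.from (arcs _ _)
      (≡.subst₂ (E π) (≡.sym (strictlyInverseˡ j)) (≡.sym (strictlyInverseˡ i)) inv)))
    where open Inverse g

  D≅flip⇒geoIsomorphic : D σ ≅ D (flip π) → GeoIsomorphic (K̄₂ Kσ) (K̄₂ Kπ)
  D≅flip⇒geoIsomorphic (g , arcs) = symmetry⇒geoIsomorphic (exchangeHubs h)
    (λ { a a → ⇔-id _ ; a b → ⇔-id _ ; a (mid _) → ⇔-id _
       ; b a → ⇔-id _ ; b b → ⇔-id _ ; b (mid _) → ⇔-id _
       ; (mid _) a → ⇔-id _ ; (mid _) b → ⇔-id _ ; (mid _) (mid _) → ⇔-id _ })
    -- The image of the edge at `a` is now an edge at `b`; the swap restores the order in which a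
    -- crossing reads as an inversion.
    (λ {i} {j} inv → π.crosses-swap (Equivalence.from (π.crosses⇔inversion _ _)
      (Equivalence.to (arcs′ j i) inv)))
    (λ {i} {j} inv → σ.crosses-swap (Equivalence.from (σ.crosses⇔inversion _ _)
      (Equivalence.from (arcs′ _ _)
        (≡.subst₂ (E π) (≡.sym (strictlyInverseˡ j)) (≡.sym (strictlyInverseˡ i)) inv))))
    where
    h : Fin n ↔ Fin n
    -- `g` lands in the vertices of `D (flip π)`, which are places around `a`; `π` turns places into
    -- labels.
    h = π ↔-∘ g
    open Inverse h using (to; strictlyInverseˡ)

    arcs′ : ∀ i j → E σ i j ⇔ E π (to j) (to i)
    arcs′ i j = ⇔-sym (E-flip π (to j) (to i)) ⇔-∘
      ≡.subst₂ (λ k l → E σ i j ⇔ E (flip π) k l) (≡.sym (inverseˡ π)) (≡.sym (inverseˡ π)) (arcs i j)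

  module _ (iso : GeoIsomorphic (K̄₂ Kσ) (K̄₂ Kπ)) where

    private
      φ = proj₁ iso
      open Inverse φ
      adjacent⇔ = proj₁ (proj₂ iso)
      crosses⇔ = proj₂ (proj₂ iso)

    -- The constant property keeps only the existence of an inversion, so the images of the hubs may
    -- be arbitrary.
    σ-inversion⇒π-inversion : ∀ {i j} → E σ i j → ∃[ k ] ∃[ l ] E π k l
    σ-inversion⇒π-inversion inv = π.crosses-elim (λ _ _ _ _ → ∃[ k ] ∃[ l ] E π k l) id id (λ inv → _ , _ , inv)
      (Equivalence.to (crosses⇔ _ _ _ _) (Equivalence.from (σ.crosses⇔inversion _ _) inv))

    π-inversion⇒σ-inversion : ∀ {i j} → E π i j → ∃[ k ] ∃[ l ] E σ k l
    π-inversion⇒σ-inversion inv = σ.crosses-elim (λ _ _ _ _ → ∃[ k ] ∃[ l ] E σ k l) id id (λ inv → _ , _ , inv)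
      (Equivalence.from (crosses⇔ _ _ _ _)
        (resp₄ Crossesπ (≡.sym ∘ strictlyInverseˡ) (Equivalence.from (π.crosses⇔inversion _ _) inv)))

    -- For n = 2 a geo-isomorphism may exchange {a , b} with {1 , 2}, but it still
    -- tells whether there is a crossing at all.
    unique<⇒D≅ : (∀ {i j k l : Fin n} → i < j → k < l → i ≡ k × j ≡ l) → D σ ≅ D π
    unique<⇒D≅ unique = ↔-id _ , λ i j → mk⇔
      (λ inv → transport {π} {σ} inv (σ-inversion⇒π-inversion inv))
      (λ inv → transport {σ} {π} inv (π-inversion⇒σ-inversion inv))
      where
      transport : ∀ {ρ τ : Permutation′ n} {i j} → E τ i j → ∃[ k ] ∃[ l ] E ρ k l → E ρ i j
      transport (i<j , _) (_ , _ , inv@(k<l , _)) with unique i<j k<l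
      ... | ≡.refl , ≡.refl = inv

    module _ (hub : Hub (to a)) where

      private
        module A = Automorphism φ adjacent⇔
        g = A.mids hub
        module g = Inverse g

      -- The images of the hubs are variables tied by equations, so that both cases of `hubs-image`
      -- can be substituted.
      inversion⇔image : ∀ {x y} → to a ≡ x → to b ≡ y → ∀ i j →
        E σ i j ⇔ Crossesπ x (mid (g.to j)) y (mid (g.to i))
      inversion⇔image ≡.refl ≡.refl i j =
        ≡.subst₂ (λ k l → E σ i j ⇔ Crossesπ (to a) k (to b) l)
          (proj₂ (A.to-mid hub j)) (proj₂ (A.to-mid hub i))
          (crosses⇔ a (mid j) b (mid i) ⇔-∘ ⇔-sym (σ.crosses⇔inversion j i))

      hub⇒D≅ : D σ ≅ D π ⊎ D σ ≅ D (flip π)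
      hub⇒D≅ = [ (λ (a≡ , b≡) → inj₁ (g , λ i j →
                   π.crosses⇔inversion _ _ ⇔-∘ inversion⇔image a≡ b≡ i j))
               -- With the hubs exchanged, an arc from `i` to `j` corresponds to one of `D π` from
               -- the image of `j` to that of `i`; following `g` by the inverse of `π` restores the
               -- direction.
               , (λ (a≡ , b≡) → inj₂ (flip π ↔-∘ g , λ i j →
                   (E-flip π _ _ ⇔-∘ π.crosses⇔inversion _ _) ⇔-∘
                   (mk⇔ π.crosses-swap π.crosses-swap ⇔-∘ inversion⇔image a≡ b≡ i j)))
               ]′ (A.hubs-image hub)

-- Up to `n = 2` there is at most one pair `i < j`, and the first alternative always holds; from
-- `n = 3` on, `a-hub` applies.
geoIsomorphic⇒D≅ : ∀ {c ℓ₁ ℓ₂ ℓ₃} (F : OrderedField c ℓ₁ ℓ₂ ℓ₃) → let open Plane F in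
  ∀ {n} {π σ : Permutation′ n} (Kσ : Realization σ) (Kπ : Realization π) →
  GeoIsomorphic (K̄₂ Kσ) (K̄₂ Kπ) → D σ ≅ D π ⊎ D σ ≅ D (flip π)
geoIsomorphic⇒D≅ F {0} Kσ Kπ iso = inj₁ (unique<⇒D≅ F Kσ Kπ iso λ { {()} })
geoIsomorphic⇒D≅ F {1} Kσ Kπ iso = inj₁ (unique<⇒D≅ F Kσ Kπ iso λ { {zero} {zero} () })
geoIsomorphic⇒D≅ F {2} Kσ Kπ iso = inj₁ (unique<⇒D≅ F Kσ Kπ iso <-unique-Fin2)
geoIsomorphic⇒D≅ F {ℕ.suc (ℕ.suc (ℕ.suc n))} Kσ Kπ iso@(φ , adjacent⇔ , _) =
  hub⇒D≅ F Kσ Kπ iso (a-hub φ adjacent⇔)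

theorem4 : ∀ {c ℓ₁ ℓ₂ ℓ₃} (F : OrderedField c ℓ₁ ℓ₂ ℓ₃) →
    let open Plane F in
    ∀ {n : ℕ} (π σ : Permutation′ n) →
    (Kσ : Realization σ) (Kπ : Realization π) →
    GeoIsomorphic (K̄₂ Kσ) (K̄₂ Kπ) ⇔ (D σ ≅ D π ⊎ D σ ≅ D (flip π))
theorem4 F π σ Kσ Kπ = mk⇔
  (geoIsomorphic⇒D≅ F Kσ Kπ)
  [ D≅⇒geoIsomorphic F Kσ Kπ , D≅flip⇒geoIsomorphic F Kσ Kπ ]′
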